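{- Let $G$ be a balanced $p$-critical interval graph and let $z$ be a vertex of maximum weight in $G$. If $C$ is an exterior local component at $z$, then $C$ consists of exactly two vertices.
   Context: A finite simple graph $G=(V,E)$ is an interval graph if there is an assignment (representation) $\alpha: v\mapsto I_v$ of vertices to intervals of the real line such that $vw\in E$ iff $I_v\cap I_w\neq\emptyset$. For a representation $\alpha$ and vertex $z$, $\mathrm{imp}_\alpha(z)$ is the number of intervals $I_w$, $w\ne z$, contained in $I_z$; $\mathrm{imp}(\alpha)=\max_z\mathrm{imp}_\alpha(z)$; the impropriety is $\mathrm{imp}(G)=\min_\alpha\mathrm{imp}(\alpha)$. A local component at $z$ is a connected component of $G\setminus\{z\}$; it is exterior if it contains a vertex not adjacent to $z$. If $z$ has $n$ local components, $\mathrm{wt}(z)$ is the sum of the $n-2$ smallest orders among the non-exterior local components at $z$ ($0$ if $n\le2$), and $\mathrm{wt}(G)=\max_z\mathrm{wt}(z)$. $G$ is balanced if $\mathrm{wt}(G)=\mathrm{imp}(G)$. For an integer $p>0$, an interval graph $G$ is $p$-critical if $\mathrm{imp}(G)=p$ and every proper induced subgraph of $G$ has impropriety strictly less than $p$. -}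

module Defs where

open import Data.Nat using (ℕ; zero; suc; _∸_; _<_; _≤_)
open import Data.Nat.Properties using (≤-decTotalOrder)
open import Data.Bool using (Bool; true; false)
open import Data.Fin using (Fin)
open import Data.Fin.Properties using (any?) renaming (_≟_ to _≟ᶠ_)
open import Data.Fin.Subset using (Subset; _∈_; _∉_; ⊤; ∣_∣)
open import Data.Fin.Subset.Properties using (_∈?_)
open import Data.List using (List; filter; map; length; take; allFin)
open import Data.Nat.ListAction using (sum)
open import Data.List.Relation.Unary.All using (All)
open import Data.List.Relation.Unary.Unique.Propositional using (Unique)
import Data.List.Membership.Propositional as LM
open import Data.Product using (Σ; ∃; _×_; _,_; proj₁; proj₂)
open import Data.Product.Properties using () 
open import Relation.Nullary using (¬_; Dec)
open import Relation.Nullary.Decidable using (_×-dec_; ¬?)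
open import Relation.Binary.PropositionalEquality using (_≡_; _≢_)
open import Data.Rational using (ℚ) renaming (_≤_ to _≤ℚ_)
open import Data.Rational.Properties using () renaming (_≤?_ to _≤ℚ?_)
import Data.List.Sort

record Graph (n : ℕ) : Set where
  field
    adj   : Fin n → Fin n → Bool
    sym   : ∀ u v → adj u v ≡ adj v u
    irref : ∀ v → adj v v ≡ false
open Graph public

record Interval : Set where
  constructor [_,_]
  field
    lo : ℚ
    hi : ℚ
open Interval public

ValidInterval : Interval → Set
ValidInterval I = lo I ≤ℚ hi I

Meets : Interval → Interval → Set
Meets I J = (lo I ≤ℚ hi J) × (lo J ≤ℚ hi I)

ContainedIn : Interval → Interval → Set
ContainedIn J I = (lo I ≤ℚ lo J) × (hi J ≤ℚ hi I)

containedIn? : ∀ J I → Dec (ContainedIn J I)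
containedIn? J I = (lo I ≤ℚ? lo J) ×-dec (hi J ≤ℚ? hi I)

module _ {n : ℕ} (G : Graph n) where

  IsRep : Subset n → (Fin n → Interval) → Set
  IsRep S α =
    (∀ v → v ∈ S → ValidInterval (α v)) ×
    (∀ v w → v ∈ S → w ∈ S → v ≢ w → (adj G v w ≡ true → Meets (α v) (α w))
                                     × (Meets (α v) (α w) → adj G v w ≡ true))

  impAt : Subset n → (Fin n → Interval) → Fin n → ℕ
  impAt S α z = length (filter (λ w → (w ∈? S) ×-dec (¬? (w ≟ᶠ z)) ×-dec containedIn? (α w) (α z))
                               (allFin n))

  HasRepImp≤ : Subset n → ℕ → Set
  HasRepImp≤ S k = ∃ λ α → IsRep S α × (∀ z → z ∈ S → impAt S α z ≤ k)

  -- G[S] is an interval graph and imp(G[S]) = p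
  ImpIs : Subset n → ℕ → Set
  ImpIs S p = HasRepImp≤ S p × (∀ k → HasRepImp≤ S k → p ≤ k)

  Critical : ℕ → Set
  Critical p = ImpIs ⊤ p ×
    (∀ S → (∃ λ v → v ∉ S) → ∃ λ k → k < p × HasRepImp≤ S k)

  data WalkIn (C : Subset n) : Fin n → Fin n → Set where
    here : ∀ {u} → u ∈ C → WalkIn C u u
    step : ∀ {u w v} → u ∈ C → adj G u w ≡ true → WalkIn C w v → WalkIn C u v

  LocalComponent : Fin n → Subset n → Set
  LocalComponent z C =
    z ∉ C ×
    (∃ λ v → v ∈ C) ×
    (∀ u v → u ∈ C → v ∈ C → WalkIn C u v) ×
    (∀ u v → u ∈ C → v ≢ z → adj G u v ≡ true → v ∈ C)

  Exterior : Fin n → Subset n → Set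
  Exterior z C = ∃ λ v → v ∈ C × adj G z v ≡ false

  exterior? : ∀ z C → Dec (Exterior z C)
  exterior? z C = any? (λ v → (v ∈? C) ×-dec (adj G z v Data.Bool.≟ false))
    where import Data.Bool

  open Data.List.Sort ≤-decTotalOrder using (sort)

  WtIs : Fin n → ℕ → Set
  WtIs z w = ∃ λ (Cs : List (Subset n)) →
    All (LocalComponent z) Cs × Unique Cs ×
    (∀ C → LocalComponent z C → C LM.∈ Cs) ×
    w ≡ sum (take (length Cs ∸ 2)
                  (sort (map ∣_∣ (filter (λ C → ¬? (exterior? z C)) Cs))))

  WtGIs : ℕ → Set
  WtGIs m = (∃ λ z → WtIs z m) × (∀ z w → WtIs z w → w ≤ m)

  Balanced : Set
  Balanced = ∃ λ m → WtGIs m × ImpIs ⊤ m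

  MaxWeight : Fin n → Set
  MaxWeight z = ∃ λ w → WtIs z w × (∀ z' w' → WtIs z' w' → w' ≤ w)

{-# OPTIONS --safe #-}

-- In a representation of an induced subgraph containing z, a local component at
-- z that is not inside I_z covers an end point of I_z, and distinct components
-- cannot cover the same end point; so all but two of them lie inside I_z and
-- imp ≥ wt(z).  This only needs each exterior component to retain an edge uv
-- with u adjacent to z and v not.  Such an edge exists in C because a critical
-- graph is connected (representations of the two sides of a disconnection can
-- be placed side by side).  Deleting the rest of C therefore keeps imp ≥ p, and
-- criticality leaves C = {u, v}.

module Submission where

open import Defs hiding (sym)
open import Data.Nat using (ℕ; zero; suc; _+_; _∸_; _⊔_; _≤_; _<_; z≤n; s≤s)
import Data.Nat.Properties as ℕ
open import Data.Nat.ListAction using (sum)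
open import Data.Nat.ListAction.Properties using (sum-↭)
open import Data.Bool using (true; false)
import Data.Bool.Properties as Bool
open import Data.Fin using (Fin; zero; suc)
import Data.Fin.Properties as Fin
open import Data.Fin.Subset using (Subset; inside; outside; _∈_; _∉_; _⊆_; ⊤; ∁; _∪_; ⁅_⁆; _-_; ∣_∣)
open import Data.Fin.Subset.Properties
open import Data.List using (List; []; _∷_; _++_; length; map; filter; take; tabulate; allFin)
open import Data.List.Properties using (++-assoc; length-++; length-map; map-++)
open import Data.List.Membership.Propositional using () renaming (_∈_ to _∈ˡ_)
open import Data.List.Membership.Propositional.Properties using (∈-∃++; ∈-++⁻; ∈-filter⁻)
open import Data.List.Relation.Binary.Permutation.Propositional using (_↭_; prep; ↭-refl; ↭-sym; ↭-trans; ↭-reflexive)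
open import Data.List.Relation.Binary.Permutation.Propositional.Properties using (∈-resp-↭; map⁺; ↭-length; shift; drop-∷; ++⁺ʳ)
open import Data.List.Relation.Unary.All as All using (All; []; _∷_)
open import Data.List.Relation.Unary.AllPairs using (AllPairs; []; _∷_)
open import Data.List.Relation.Unary.Any using (here; there)
open import Data.List.Relation.Unary.Sorted.TotalOrder.Properties using (Sorted⇒AllPairs)
open import Data.List.Relation.Unary.Unique.Propositional using (Unique)
import Data.List.Relation.Unary.Unique.Propositional.Properties as Unique
open import Data.List.Sort ℕ.≤-decTotalOrder using (sort; sort-↭; sort-↗)
open import Data.Product using (∃; ∃₂; _×_; _,_; proj₁; proj₂)
open import Data.Rational using (ℚ; 0ℚ; 1ℚ) renaming (_+_ to _+ℚ_; _-_ to _-ℚ_; -_ to -ℚ_; _≤_ to _≤ℚ_; _<_ to _<ℚ_; _⊔_ to _⊔ℚ_)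
import Data.Rational.Properties as ℚ
open import Data.Sum using (_⊎_; inj₁; inj₂; [_,_]′)
open import Data.Vec using ([]; _∷_; here; there)
import Data.Vec.Properties as Vec
open import Function using (_∘_; id)
open import Relation.Binary.PropositionalEquality using (_≡_; _≢_; refl; sym; trans; cong; subst; subst₂)
open import Relation.Nullary using (¬_; Dec; yes; no; contradiction)
open import Relation.Nullary.Decidable using (_×-dec_; _⊎-dec_; ¬?)
open import Relation.Unary using (Decidable)

-- Lists

module _ {A : Set} where

  filter-split : {P : A → Set} (P? : Decidable P) (xs : List A) →
    xs ↭ filter P? xs ++ filter (¬? ∘ P?) xs
  filter-split P? [] = ↭-refl
  filter-split P? (x ∷ xs) with P? x
  ... | yes _ = prep x (filter-split P? xs)
  ... | no  _ = ↭-trans (prep x (filter-split P? xs)) (↭-sym (shift x _ _))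

  length-filter-split : {P : A → Set} (P? : Decidable P) (xs : List A) →
    length xs ≡ length (filter P? xs) + length (filter (¬? ∘ P?) xs)
  length-filter-split P? xs =
    trans (↭-length (filter-split P? xs)) (length-++ (filter P? xs))

  filter-filter : {P Q : A → Set} (P? : Decidable P) (Q? : Decidable Q) (xs : List A) →
    (∀ x → x ∈ˡ xs → Q x → P x) → filter Q? (filter P? xs) ≡ filter Q? xs
  filter-filter P? Q? [] Q⇒P = refl
  filter-filter P? Q? (x ∷ xs) Q⇒P with ih ← filter-filter P? Q? xs (λ y → Q⇒P y ∘ there) | P? x
  ... | yes _ with Q? x
  ...   | yes _ = cong (x ∷_) ih
  ...   | no  _ = ih
  filter-filter P? Q? (x ∷ xs) Q⇒P | no ¬p with Q? x
  ...   | yes q = contradiction (Q⇒P x (here refl) q) ¬p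
  ...   | no  _ = ih

  length-filter-⊎ : {P Q : A → Set} (P? : Decidable P) (Q? : Decidable Q) (xs : List A) →
    length (filter (λ x → P? x ⊎-dec Q? x) xs) ≤ length (filter P? xs) + length (filter Q? xs)
  length-filter-⊎ P? Q? [] = z≤n
  length-filter-⊎ P? Q? (x ∷ xs) with ih ← length-filter-⊎ P? Q? xs | P? x | Q? x
  ... | yes _ | yes _ = s≤s (ℕ.≤-trans ih (ℕ.+-monoʳ-≤ (length (filter P? xs)) (ℕ.n≤1+n _)))
  ... | yes _ | no  _ = s≤s ih
  ... | no  _ | yes _ = ℕ.≤-trans (s≤s ih) (ℕ.≤-reflexive (sym (ℕ.+-suc _ _)))
  ... | no  _ | no  _ = ih

  length-filter-mono : {P Q : A → Set} (P? : Decidable P) (Q? : Decidable Q) →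
    (∀ x → P x → Q x) → ∀ xs → length (filter P? xs) ≤ length (filter Q? xs)
  length-filter-mono P? Q? P⇒Q [] = z≤n
  length-filter-mono P? Q? P⇒Q (x ∷ xs) with ih ← length-filter-mono P? Q? P⇒Q xs | P? x | Q? x
  ... | yes _ | yes _ = s≤s ih
  ... | yes p | no ¬q = contradiction (P⇒Q x p) ¬q
  ... | no  _ | yes _ = ℕ.m≤n⇒m≤1+n ih
  ... | no  _ | no  _ = ih

  length-filter-× : {P Q : A → Set} (P? : Decidable P) (Q? : Decidable Q) →
    (∀ x → Q x → P x) → ∀ xs →
    length (filter Q? xs) + length (filter (λ x → P? x ×-dec ¬? (Q? x)) xs) ≤ length (filter P? xs)
  length-filter-× P? Q? Q⇒P [] = z≤n
  length-filter-× P? Q? Q⇒P (x ∷ xs) with ih ← length-filter-× P? Q? Q⇒P xs | P? x | Q? x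
  ... | yes _ | yes _ = s≤s ih
  ... | yes _ | no  _ = ℕ.≤-trans (ℕ.≤-reflexive (ℕ.+-suc _ _)) (s≤s ih)
  ... | no ¬p | yes q = contradiction (Q⇒P x q) ¬p
  ... | no  _ | no  _ = ih

  length≤1 : (xs : List A) → Unique xs → (∀ x y → x ∈ˡ xs → y ∈ˡ xs → x ≡ y) → length xs ≤ 1
  length≤1 []           _                 _  = z≤n
  length≤1 (_ ∷ [])     _                 _  = s≤s z≤n
  length≤1 (x ∷ y ∷ xs) ((x≢y ∷ _) ∷ _) eq =
    contradiction (eq x y (here refl) (there (here refl))) x≢y

  length-filter≤1 : {P : A → Set} (P? : Decidable P) (xs : List A) → Unique xs →
    (∀ x y → x ∈ˡ xs → y ∈ˡ xs → P x → P y → x ≡ y) → length (filter P? xs) ≤ 1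
  length-filter≤1 P? xs uniq eq =
    length≤1 (filter P? xs) (Unique.filter⁺ P? uniq) λ x y x∈ y∈ →
      let x∈xs , px = ∈-filter⁻ P? x∈
          y∈xs , py = ∈-filter⁻ P? y∈
      in eq x y x∈xs y∈xs px py

-- If the least element is not among the chosen ones, exchange it for one of them.
sum-take-least : ∀ m xs ys zs → AllPairs _≤_ xs → xs ↭ ys ++ zs → m ≤ length ys →
  sum (take m xs) ≤ sum ys
sum-take-least zero    xs       ys zs _ _ _ = z≤n
sum-take-least (suc m) []       ys zs _ _ _ = z≤n
sum-take-least (suc m) (x ∷ xs) ys@(y ∷ ys′) zs (x≤xs ∷ sorted) perm (s≤s m≤)
  with ∈-++⁻ ys (∈-resp-↭ perm (here refl))
... | inj₁ x∈ys with as , bs , eq ← ∈-∃++ x∈ys =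
  ℕ.≤-trans (ℕ.+-monoʳ-≤ x (sum-take-least m xs (as ++ bs) zs sorted xs↭ m≤as++bs))
            (ℕ.≤-reflexive (sym (sum-↭ ys↭)))
  where
  ys↭ : ys ↭ x ∷ as ++ bs
  ys↭ = ↭-trans (↭-reflexive eq) (shift x as bs)
  xs↭ : xs ↭ (as ++ bs) ++ zs
  xs↭ = drop-∷ (↭-trans perm (++⁺ʳ zs ys↭))
  m≤as++bs : m ≤ length (as ++ bs)
  m≤as++bs = ℕ.≤-trans m≤ (ℕ.≤-reflexive (ℕ.suc-injective (↭-length ys↭)))
... | inj₂ x∈zs with as , bs , refl ← ∈-∃++ x∈zs =
  ℕ.+-mono-≤ x≤y (sum-take-least m xs ys′ (y ∷ as ++ bs) sorted xs↭ m≤)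
  where
  x≤y : x ≤ y
  x≤y with ∈-resp-↭ (↭-sym perm) (here refl)
  ... | here refl   = ℕ.≤-refl
  ... | there y∈xs = All.lookup x≤xs y∈xs
  perm′ : x ∷ xs ↭ x ∷ (ys ++ as ++ bs)
  perm′ = ↭-trans perm (↭-trans (↭-reflexive (sym (++-assoc ys as (x ∷ bs))))
            (↭-trans (shift x (ys ++ as) bs)
              (prep x (↭-reflexive (++-assoc ys as bs)))))
  xs↭ : xs ↭ ys′ ++ y ∷ as ++ bs
  xs↭ = ↭-trans (drop-∷ perm′) (↭-sym (shift y ys′ (as ++ bs)))

-- Finite subsets

∣p∪q∣≤∣p∣+∣q∣ : ∀ {n} (p q : Subset n) → ∣ p ∪ q ∣ ≤ ∣ p ∣ + ∣ q ∣
∣p∪q∣≤∣p∣+∣q∣ [] [] = z≤n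
∣p∪q∣≤∣p∣+∣q∣ (inside  ∷ p) (inside  ∷ q) =
  s≤s (ℕ.≤-trans (∣p∪q∣≤∣p∣+∣q∣ p q) (ℕ.+-monoʳ-≤ ∣ p ∣ (ℕ.n≤1+n _)))
∣p∪q∣≤∣p∣+∣q∣ (inside  ∷ p) (outside ∷ q) = s≤s (∣p∪q∣≤∣p∣+∣q∣ p q)
∣p∪q∣≤∣p∣+∣q∣ (outside ∷ p) (inside  ∷ q) =
  ℕ.≤-trans (s≤s (∣p∪q∣≤∣p∣+∣q∣ p q)) (ℕ.≤-reflexive (sym (ℕ.+-suc _ _)))
∣p∪q∣≤∣p∣+∣q∣ (outside ∷ p) (outside ∷ q) = ∣p∪q∣≤∣p∣+∣q∣ p q

∣pair∣≡2 : ∀ {n} {C : Subset n} {u v} → u ∈ C → v ∈ C → u ≢ v → C ⊆ ⁅ u ⁆ ∪ ⁅ v ⁆ → ∣ C ∣ ≡ 2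
∣pair∣≡2 {C = C} {u} {v} u∈C v∈C u≢v C⊆uv = ℕ.≤-antisym upper lower
  where
  upper : ∣ C ∣ ≤ 2
  upper = ℕ.≤-trans (p⊆q⇒∣p∣≤∣q∣ C⊆uv) (ℕ.≤-trans (∣p∪q∣≤∣p∣+∣q∣ ⁅ u ⁆ ⁅ v ⁆)
            (ℕ.+-mono-≤ (ℕ.≤-reflexive (∣⁅x⁆∣≡1 u)) (ℕ.≤-reflexive (∣⁅x⁆∣≡1 v))))
  lower : 2 ≤ ∣ C ∣
  lower = ℕ.≤-trans (s≤s (ℕ.≤-trans (s≤s z≤n) (x∈p⇒∣p-x∣<∣p∣ v∈C-u))) (x∈p⇒∣p-x∣<∣p∣ u∈C)
    where
    v∈C-u : v ∈ C - u
    v∈C-u = x∈p∧x≢y⇒x∈p-y v∈C (u≢v ∘ sym)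

-- Counting over `tabulate f` rather than `allFin` keeps the induction going: passing to the tail of
-- `D` turns `f` into `f ∘ suc`.
∣p∣≤length-filter-tabulate : ∀ {n} {A : Set} {P : A → Set} (P? : Decidable P) (f : Fin n → A) (D : Subset n) →
  (∀ x → x ∈ D → P (f x)) → ∣ D ∣ ≤ length (filter P? (tabulate f))
∣p∣≤length-filter-tabulate P? f [] D⇒P = z≤n
∣p∣≤length-filter-tabulate P? f (inside ∷ D) D⇒P
  with ih ← ∣p∣≤length-filter-tabulate P? (f ∘ suc) D (λ x → D⇒P (suc x) ∘ there) | P? (f zero)
... | yes _ = s≤s ih
... | no ¬p = contradiction (D⇒P zero here) ¬p
∣p∣≤length-filter-tabulate P? f (outside ∷ D) D⇒P
  with ih ← ∣p∣≤length-filter-tabulate P? (f ∘ suc) D (λ x → D⇒P (suc x) ∘ there) | P? (f zero)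
... | yes _ = ℕ.m≤n⇒m≤1+n ih
... | no  _ = ih

Disjoint : ∀ {n} → Subset n → Subset n → Set
Disjoint D E = ∀ x → x ∈ D → x ∉ E

-- Splitting off `D` strengthens `P` by non-membership in `D`. Disjointness hands the stronger
-- predicate to the remaining sets, so no element is counted twice.
sum-∣disjoint∣≤ : ∀ {n} {P : Fin n → Set} (P? : Decidable P) (Ds : List (Subset n)) →
  AllPairs Disjoint Ds → All (λ D → ∀ x → x ∈ D → P x) Ds →
  sum (map ∣_∣ Ds) ≤ length (filter P? (allFin n))
sum-∣disjoint∣≤ P? [] _ _ = z≤n
sum-∣disjoint∣≤ {n} P? (D ∷ Ds) (disj ∷ disjs) (D⇒P ∷ Ds⇒P) =
  ℕ.≤-trans (ℕ.+-mono-≤ (∣p∣≤length-filter-tabulate (_∈? D) id D (λ _ → id))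
                         (sum-∣disjoint∣≤ (λ x → P? x ×-dec ¬? (x ∈? D)) Ds disjs
                           (All.zipWith (λ { (d , E⇒P) x x∈E → E⇒P x x∈E , λ x∈D → d x x∈D x∈E })
                                        (disj , Ds⇒P))))
            (length-filter-× P? (_∈? D) D⇒P (allFin n))

-- Translated intervals

strictUpperBound : ∀ {n} (f : Fin n → ℚ) → ∃ λ M → ∀ i → f i <ℚ M
strictUpperBound {zero}  f = 0ℚ , λ ()
strictUpperBound {suc n} f with M , f<M ← strictUpperBound (f ∘ suc) =
  (f zero +ℚ 1ℚ) ⊔ℚ M , bound
  where
  f<f+1 : f zero <ℚ f zero +ℚ 1ℚ
  f<f+1 = subst (_<ℚ f zero +ℚ 1ℚ) (ℚ.+-identityʳ (f zero)) (ℚ.+-monoʳ-< (f zero) (ℚ.positive⁻¹ 1ℚ))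
  bound : ∀ i → f i <ℚ (f zero +ℚ 1ℚ) ⊔ℚ M
  bound zero    = ℚ.<-≤-trans f<f+1 (ℚ.p≤p⊔q (f zero +ℚ 1ℚ) M)
  bound (suc i) = ℚ.<-≤-trans (f<M i) (ℚ.p≤q⊔p (f zero +ℚ 1ℚ) M)

p-q<r⇒p<q+r : ∀ {p q r} → p -ℚ q <ℚ r → p <ℚ q +ℚ r
p-q<r⇒p<q+r {p} {q} {r} p-q<r = subst₂ _<ℚ_ p-q+q≡p (ℚ.+-comm r q) (ℚ.+-monoˡ-< q p-q<r)
  where
  p-q+q≡p : (p -ℚ q) +ℚ q ≡ p
  p-q+q≡p = trans (ℚ.+-assoc p (-ℚ q) q)
              (trans (cong (p +ℚ_) (ℚ.+-inverseˡ q)) (ℚ.+-identityʳ p))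

+-cancelʳ-≤ : ∀ r {p q} → p +ℚ r ≤ℚ q +ℚ r → p ≤ℚ q
+-cancelʳ-≤ r p+r≤q+r = ℚ.≮⇒≥ λ q<p → ℚ.<-irrefl refl (ℚ.<-≤-trans (ℚ.+-monoˡ-< r q<p) p+r≤q+r)

translate : ℚ → Interval → Interval
translate M I = [ lo I +ℚ M , hi I +ℚ M ]

module _ {n : ℕ} (G : Graph n) where

  adj-sym : ∀ {u v} → adj G u v ≡ true → adj G v u ≡ true
  adj-sym {u} {v} e = trans (Graph.sym G v u) e

  -- Connectedness

  module SideBySide (D : Subset n) (noEdge : ∀ u v → u ∈ D → v ∉ D → adj G u v ≢ true)
      {k₁ k₂ : ℕ} (rep₁ : HasRepImp≤ G D k₁) (rep₂ : HasRepImp≤ G (∁ D) k₂) where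

    α₁ α₂ : Fin n → Interval
    α₁ = proj₁ rep₁
    α₂ = proj₁ rep₂

    -- Bounding the differences `hi (α₁ v) -ℚ lo (α₂ w)` first over `w` and then over `v` gives one
    -- shift that serves all pairs.
    gap : ∃ λ M → ∀ v w → hi (α₁ v) <ℚ lo (α₂ w) +ℚ M
    gap with M , bound ← strictUpperBound (λ v → proj₁ (strictUpperBound (λ w → hi (α₁ v) -ℚ lo (α₂ w)))) =
      M , λ v w → p-q<r⇒p<q+r {hi (α₁ v)}
            (ℚ.<-trans (proj₂ (strictUpperBound (λ w → hi (α₁ v) -ℚ lo (α₂ w))) w) (bound v))

    M : ℚ
    M = proj₁ gap

    α : Fin n → Interval
    α v with v ∈? D
    ... | yes _ = α₁ v
    ... | no  _ = translate M (α₂ v)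

    -- The free point `p` gives the lemma two uses: taken as the translated left end, it refutes
    -- that intervals of opposite sides meet; taken as an end of a contained interval, it refutes
    -- containment across the gap.
    separated : ∀ {p} v w → lo (α₂ w) +ℚ M ≤ℚ p → ¬ p ≤ℚ hi (α₁ v)
    separated v w lo≤p p≤hi = ℚ.<-irrefl refl (ℚ.<-≤-trans (proj₂ gap v w) (ℚ.≤-trans lo≤p p≤hi))

    valid : ∀ v → ValidInterval (α v)
    valid v with v ∈? D
    ... | yes v∈ = proj₁ (proj₁ (proj₂ rep₁)) v v∈
    ... | no  v∉ = ℚ.+-monoˡ-≤ M (proj₁ (proj₁ (proj₂ rep₂)) v (x∉p⇒x∈∁p v∉))

    meets : ∀ v w → v ≢ w → (adj G v w ≡ true → Meets (α v) (α w))
                          × (Meets (α v) (α w) → adj G v w ≡ true)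
    meets v w v≢w with v ∈? D | w ∈? D
    ... | yes v∈ | yes w∈ = proj₂ (proj₁ (proj₂ rep₁)) v w v∈ w∈ v≢w
    ... | yes v∈ | no  w∉ =
      (λ e → contradiction e (noEdge v w v∈ w∉)) ,
      (λ (_ , lo≤hi) → contradiction lo≤hi (separated v w ℚ.≤-refl))
    ... | no  v∉ | yes w∈ =
      (λ e → contradiction (adj-sym e) (noEdge w v w∈ v∉)) ,
      (λ (lo≤hi , _) → contradiction lo≤hi (separated w v ℚ.≤-refl))
    ... | no  v∉ | no  w∉
      with to , from ← proj₂ (proj₁ (proj₂ rep₂)) v w (x∉p⇒x∈∁p v∉) (x∉p⇒x∈∁p w∉) v≢w =
      (λ e → ℚ.+-monoˡ-≤ M (proj₁ (to e)) , ℚ.+-monoˡ-≤ M (proj₂ (to e))) ,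
      (λ (a , b) → from (+-cancelʳ-≤ M a , +-cancelʳ-≤ M b))

    -- Validity of `α w` excludes containment across the gap; an interval with `hi` below `lo` could
    -- be contained in one it does not meet. Hence each vertex counts only vertices of its own side,
    -- and the union has impropriety at most the larger of the two.
    contained₁ : ∀ v w → v ∈ D → ContainedIn (α w) (α v) → w ∈ D × ContainedIn (α₁ w) (α₁ v)
    contained₁ v w v∈ c with v ∈? D | w ∈? D | valid w
    ... | yes _ | yes w∈ | _ = w∈ , c
    ... | yes _ | no _ | lo≤hi = contradiction (proj₂ c) (separated v w lo≤hi)
    ... | no v∉ | _ | _ = contradiction v∈ v∉

    contained₂ : ∀ v w → v ∉ D → ContainedIn (α w) (α v) → w ∈ ∁ D × ContainedIn (α₂ w) (α₂ v)
    contained₂ v w v∉ c with v ∈? D | w ∈? D | valid w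
    ... | no _ | no w∉ | _ = x∉p⇒x∈∁p w∉ , +-cancelʳ-≤ M (proj₁ c) , +-cancelʳ-≤ M (proj₂ c)
    ... | no _ | yes _ | lo≤hi = contradiction lo≤hi (separated w v (proj₁ c))
    ... | yes v∈ | _ | _ = contradiction v∈ v∉

    imp≤ : ∀ v → impAt G ⊤ α v ≤ k₁ ⊔ k₂
    imp≤ v = bound (v ∈? D)
      where
      bound : Dec (v ∈ D) → impAt G ⊤ α v ≤ k₁ ⊔ k₂
      bound (yes v∈) = ℕ.≤-trans
        (length-filter-mono _ _ (λ w (_ , w≢v , c) → let w∈ , c₁ = contained₁ v w v∈ c in w∈ , w≢v , c₁) (allFin n))
        (ℕ.≤-trans (proj₂ (proj₂ rep₁) v v∈) (ℕ.m≤m⊔n k₁ k₂))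
      bound (no v∉) = ℕ.≤-trans
        (length-filter-mono _ _ (λ w (_ , w≢v , c) → let w∈ , c₂ = contained₂ v w v∉ c in w∈ , w≢v , c₂) (allFin n))
        (ℕ.≤-trans (proj₂ (proj₂ rep₂) v (x∉p⇒x∈∁p v∉)) (ℕ.m≤n⊔m k₁ k₂))

    union : HasRepImp≤ G ⊤ (k₁ ⊔ k₂)
    union = α , ((λ v _ → valid v) , (λ v w _ _ → meets v w)) , (λ v _ → imp≤ v)

  -- Without a neighbour of `z` in `D`, no edge would leave `D`. Now `D` misses `z` and `∁ D` misses
  -- `x`, so criticality represents both sides with impropriety below `p`, and placing them side by
  -- side contradicts the minimality of `p`.
  critical⇒componentTouches : ∀ {p z D} → Critical G p → LocalComponent G z D →
    ∃ λ u → u ∈ D × adj G z u ≡ true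
  critical⇒componentTouches {p} {z} {D} ((_ , least) , crit) (z∉D , (x , x∈D) , _ , closed)
    with Fin.any? (λ u → (u ∈? D) ×-dec (adj G z u Bool.≟ true))
  ... | yes touch = touch
  ... | no  ¬touch
    with k₁ , k₁<p , rep₁ ← crit D (z , z∉D)
       | k₂ , k₂<p , rep₂ ← crit (∁ D) (x , x∈p⇒x∉∁p x∈D) =
    contradiction (least (k₁ ⊔ k₂) (SideBySide.union D noEdge rep₁ rep₂)) (ℕ.<⇒≱ (ℕ.⊔-lub k₁<p k₂<p))
    where
    noEdge : ∀ u v → u ∈ D → v ∉ D → adj G u v ≢ true
    noEdge u v u∈ v∉ e with v Fin.≟ z
    ... | yes refl = ¬touch (u , u∈ , adj-sym e)
    ... | no  v≢z  = v∉ (closed u v u∈ v≢z e)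

  -- Local components

  walk-start∈ : ∀ {D u v} → WalkIn G D u v → u ∈ D
  walk-start∈ (here u∈)     = u∈
  walk-start∈ (step u∈ _ _) = u∈

  -- A walk inside `D` avoids `z`, so the closure of `E` under adjacency away from `z` carries
  -- membership in `E` along the walk.
  localComponent-⊆ : ∀ {z D E x} → LocalComponent G z D → LocalComponent G z E → x ∈ D → x ∈ E → D ⊆ E
  localComponent-⊆ {z} {D} {E} {x} (z∉D , _ , conn , _) (_ , _ , _ , closed) x∈D x∈E y∈D =
    follow (conn x _ x∈D y∈D) x∈E
    where
    follow : ∀ {u v} → WalkIn G D u v → u ∈ E → v ∈ E
    follow (here _)       u∈E = u∈E
    follow (step _ e walk) u∈E =
      follow walk (closed _ _ u∈E (λ { refl → z∉D (walk-start∈ walk) }) e)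

  localComponent-≡ : ∀ {z D E x} → LocalComponent G z D → LocalComponent G z E → x ∈ D → x ∈ E → D ≡ E
  localComponent-≡ lcD lcE x∈D x∈E =
    ⊆-antisym (localComponent-⊆ lcD lcE x∈D x∈E) (localComponent-⊆ lcE lcD x∈E x∈D)

  localComponents-disjoint : ∀ {z Ds} → All (LocalComponent G z) Ds → Unique Ds → AllPairs Disjoint Ds
  localComponents-disjoint [] [] = []
  localComponents-disjoint (lc ∷ lcs) (D≢ ∷ uniq) =
    All.zipWith (λ { (lcE , D≢E) x x∈D x∈E → D≢E (localComponent-≡ lc lcE x∈D x∈E) }) (lcs , D≢)
    ∷ localComponents-disjoint lcs uniq

  Escape : Fin n → Subset n → Set
  Escape z D = ∃₂ λ u v → u ∈ D × v ∈ D × adj G z u ≡ true × adj G u v ≡ true × adj G z v ≡ false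

  -- The edge sought is the first one on the walk that leads from a neighbour of `z` to a
  -- non-neighbour.
  walk⇒escape : ∀ {z D u v} → WalkIn G D u v → adj G z u ≡ true → adj G z v ≡ false → Escape z D
  walk⇒escape (here _) e ¬e = contradiction (trans (sym e) ¬e) λ ()
  walk⇒escape {z} (step {u} {w} u∈ uw walk) e ¬e with adj G z w in eq
  ... | true  = walk⇒escape walk eq ¬e
  ... | false = u , w , u∈ , walk-start∈ walk , e , uw , eq

  critical⇒escape : ∀ {p z D} → Critical G p → LocalComponent G z D → Exterior G z D → Escape z D
  critical⇒escape crit lc@(_ , _ , conn , _) (v , v∈ , ¬zv)
    with u , u∈ , zu ← critical⇒componentTouches crit lc =
    walk⇒escape (conn u v u∈ v∈) zu ¬zv

  -- The weight bound

  -- The members of `Cs` are components in the whole graph, whereas `α` represents only the subgraph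
  -- on `S`. Exterior components may thus be cut down by `S`, but those whose orders enter the
  -- weight must survive whole.
  module WeightBound {z : Fin n} {S : Subset n} {α : Fin n → Interval}
      (z∈S : z ∈ S) (isRep : IsRep G S α)
      (Cs : List (Subset n)) (lcs : All (LocalComponent G z) Cs) (uniq : Unique Cs)
      (escapes : ∀ D → D ∈ˡ Cs → Exterior G z D →
        ∃₂ λ u v → (u ∈ D × u ∈ S) × (v ∈ D × v ∈ S) ×
                   adj G z u ≡ true × adj G u v ≡ true × adj G z v ≡ false)
      (inner⊆S : ∀ D → D ∈ˡ Cs → ¬ Exterior G z D → D ⊆ S) where

    adj⇒meets : ∀ {v w} → v ∈ S → w ∈ S → adj G v w ≡ true → Meets (α v) (α w)
    adj⇒meets {v} {w} v∈ w∈ e = proj₁ (proj₂ isRep v w v∈ w∈ v≢w) e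
      where
      v≢w : v ≢ w
      v≢w refl = contradiction (trans (sym e) (irref G v)) λ ()

    -- A neighbour of `z` has an interval meeting that of `z`; if it also reaches strictly beyond an
    -- end point, it contains that end point.
    CoversLeft CoversRight : Subset n → Set
    CoversLeft  D = ∃ λ w → w ∈ D × w ∈ S × adj G z w ≡ true × lo (α w) <ℚ lo (α z)
    CoversRight D = ∃ λ w → w ∈ D × w ∈ S × adj G z w ≡ true × hi (α z) <ℚ hi (α w)

    coversLeft? : Decidable CoversLeft
    coversLeft? D = Fin.any? λ w →
      (w ∈? D) ×-dec (w ∈? S) ×-dec (adj G z w Bool.≟ true) ×-dec (lo (α w) ℚ.<? lo (α z))

    coversRight? : Decidable CoversRight
    coversRight? D = Fin.any? λ w →
      (w ∈? D) ×-dec (w ∈? S) ×-dec (adj G z w Bool.≟ true) ×-dec (hi (α z) ℚ.<? hi (α w))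

    -- Distinct vertices with meeting intervals are adjacent, so they share a component. Equal
    -- vertices are treated apart because a representation constrains distinct pairs only.
    meeting⇒≡ : ∀ {D E v w} → D ∈ˡ Cs → E ∈ˡ Cs → v ∈ D → w ∈ E → v ∈ S → w ∈ S →
      Meets (α v) (α w) → D ≡ E
    meeting⇒≡ {D} {E} {v} {w} D∈ E∈ v∈D w∈E v∈S w∈S m with v Fin.≟ w
    ... | yes refl = localComponent-≡ (All.lookup lcs D∈) (All.lookup lcs E∈) v∈D w∈E
    ... | no  v≢w  = localComponent-≡ (All.lookup lcs D∈) (All.lookup lcs E∈) w∈D w∈E
      where
      w≢z : w ≢ z
      w≢z refl = proj₁ (All.lookup lcs E∈) w∈E
      w∈D : w ∈ D
      w∈D = proj₂ (proj₂ (proj₂ (All.lookup lcs D∈))) v w v∈D w≢z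
              (proj₂ (proj₂ isRep v w v∈S w∈S v≢w) m)

    -- Both intervals contain the point `lo (α z)`, so they meet.
    coversLeft-unique : ∀ D E → D ∈ˡ Cs → E ∈ˡ Cs → CoversLeft D → CoversLeft E → D ≡ E
    coversLeft-unique D E D∈ E∈ (v , v∈D , v∈S , zv , v<z) (w , w∈E , w∈S , zw , w<z) =
      meeting⇒≡ D∈ E∈ v∈D w∈E v∈S w∈S
        ( ℚ.≤-trans (ℚ.<⇒≤ v<z) (proj₁ (adj⇒meets z∈S w∈S zw))
        , ℚ.≤-trans (ℚ.<⇒≤ w<z) (proj₁ (adj⇒meets z∈S v∈S zv)))

    coversRight-unique : ∀ D E → D ∈ˡ Cs → E ∈ˡ Cs → CoversRight D → CoversRight E → D ≡ E
    coversRight-unique D E D∈ E∈ (v , v∈D , v∈S , zv , z<v) (w , w∈E , w∈S , zw , z<w) =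
      meeting⇒≡ D∈ E∈ v∈D w∈E v∈S w∈S
        ( ℚ.≤-trans (proj₂ (adj⇒meets z∈S v∈S zv)) (ℚ.<⇒≤ z<w)
        , ℚ.≤-trans (proj₂ (adj⇒meets z∈S w∈S zw)) (ℚ.<⇒≤ z<v))

    -- The interval of `v` misses that of `z` and so lies strictly to one side. Since `u` meets
    -- both, it covers the end point of `z` on that side.
    exterior⇒covers : ∀ D → D ∈ˡ Cs → Exterior G z D → CoversLeft D ⊎ CoversRight D
    exterior⇒covers D D∈ ext
      with u , v , (u∈D , u∈S) , (v∈D , v∈S) , zu , uv , ¬zv ← escapes D D∈ ext
      with lo (α z) ℚ.≤? hi (α v)
    ... | no  z≰v = inj₁ (u , u∈D , u∈S , zu ,
                      ℚ.≤-<-trans (proj₁ (adj⇒meets u∈S v∈S uv)) (ℚ.≰⇒> z≰v))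
    ... | yes z≤v = inj₂ (u , u∈D , u∈S , zu ,
                      ℚ.<-≤-trans (ℚ.≰⇒> v≰z) (proj₂ (adj⇒meets u∈S v∈S uv)))
      where
      z≢v : z ≢ v
      z≢v refl = proj₁ (All.lookup lcs D∈) v∈D
      v≰z : ¬ lo (α v) ≤ℚ hi (α z)
      v≰z v≤z = contradiction
        (trans (sym (proj₂ (proj₂ isRep z v z∈S v∈S z≢v) (z≤v , v≤z))) ¬zv) λ ()

    covers? : Decidable (λ D → CoversLeft D ⊎ CoversRight D)
    covers? D = coversLeft? D ⊎-dec coversRight? D

    inner? : Decidable (λ D → ¬ Exterior G z D)
    inner? D = ¬? (exterior? G z D)

    inside-z : List (Subset n)
    inside-z = filter (¬? ∘ covers?) Cs

    -- The 2 is one component for each end point; one that covers both is counted twice, which only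
    -- weakens the bound on the discarded components.
    length-Cs∸2≤ : length Cs ∸ 2 ≤ length inside-z
    length-Cs∸2≤ = ℕ.m≤n+o⇒m∸n≤o (length Cs) 2
      (ℕ.≤-trans (ℕ.≤-reflexive (length-filter-split covers? Cs)) (ℕ.+-monoˡ-≤ (length inside-z)
        (ℕ.≤-trans (length-filter-⊎ coversLeft? coversRight? Cs)
          (ℕ.+-mono-≤ (length-filter≤1 coversLeft?  Cs uniq coversLeft-unique)
                      (length-filter≤1 coversRight? Cs uniq coversRight-unique)))))

    inside-z⇒inner : ∀ D → D ∈ˡ Cs → ¬ (CoversLeft D ⊎ CoversRight D) → ¬ Exterior G z D
    inside-z⇒inner D D∈ ¬covers = ¬covers ∘ exterior⇒covers D D∈

    -- Being non-exterior, `D` consists of neighbours of `z`. So the failure to cover either end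
    -- applies to every vertex of `D` and confines both ends of its interval.
    inside-z⇒contained : ∀ {D} → D ∈ˡ inside-z → ∀ w → w ∈ D → w ∈ S × w ≢ z × ContainedIn (α w) (α z)
    inside-z⇒contained {D} D∈ w w∈D with D∈Cs , ¬covers ← ∈-filter⁻ (¬? ∘ covers?) D∈ =
      w∈S , (λ { refl → proj₁ (All.lookup lcs D∈Cs) w∈D })
      , ℚ.≮⇒≥ (λ w<z → ¬covers (inj₁ (w , w∈D , w∈S , zw , w<z)))
      , ℚ.≮⇒≥ (λ z<w → ¬covers (inj₂ (w , w∈D , w∈S , zw , z<w)))
      where
      inner : ¬ Exterior G z D
      inner = inside-z⇒inner D D∈Cs ¬covers
      w∈S : w ∈ S
      w∈S = inner⊆S D D∈Cs inner w∈D
      zw : adj G z w ≡ true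
      zw = Bool.¬-not (λ ¬zw → inner (w , w∈D , ¬zw))

    -- The components in `inside-z` are disjoint and have all their intervals inside that of `z`, so
    -- their total order is at most the impropriety at `z`. There are at least `length Cs ∸ 2` of
    -- them, all non-exterior, so the smallest orders sum to no more.
    weight≤imp : sum (take (length Cs ∸ 2) (sort (map ∣_∣ (filter inner? Cs)))) ≤ impAt G S α z
    weight≤imp = ℕ.≤-trans
      (sum-take-least (length Cs ∸ 2) (sort sizes) (map ∣_∣ inside-z) _
        (Sorted⇒AllPairs ℕ.≤-totalOrder (sort-↗ sizes))
        (↭-trans (sort-↭ sizes) sizes↭)
        (ℕ.≤-trans length-Cs∸2≤ (ℕ.≤-reflexive (sym (length-map ∣_∣ inside-z)))))
      (sum-∣disjoint∣≤ _ inside-z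
        (localComponents-disjoint
          (All.tabulate (λ D∈ → All.lookup lcs (proj₁ (∈-filter⁻ (¬? ∘ covers?) D∈))))
          (Unique.filter⁺ (¬? ∘ covers?) uniq))
        (All.tabulate inside-z⇒contained))
      where
      inner : List (Subset n)
      inner = filter inner? Cs
      sizes : List ℕ
      sizes = map ∣_∣ inner
      -- The components of `inside-z` are already non-exterior, so selecting them from `inner`
      -- yields the same list as selecting them from `Cs`.
      sizes↭ : sizes ↭ map ∣_∣ inside-z ++ map ∣_∣ (filter (¬? ∘ ¬? ∘ covers?) inner)
      sizes↭ = ↭-trans (map⁺ ∣_∣ (filter-split (¬? ∘ covers?) inner))
        (↭-trans (↭-reflexive (map-++ ∣_∣ (filter (¬? ∘ covers?) inner) _))
          (++⁺ʳ _ (↭-reflexive (cong (map ∣_∣) (filter-filter inner? (¬? ∘ covers?) Cs inside-z⇒inner)))))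

-- Shrinking an exterior component to an edge

theorem3p1 : ∀ {n : ℕ} (G : Graph n) (p : ℕ) → 0 < p →
    Balanced G → Critical G p →
    (z : Fin n) → MaxWeight G z →
    (C : Subset n) → LocalComponent G z C → Exterior G z C →
    ∣ C ∣ ≡ 2
theorem3p1 {n} G p _ (m , ((_ , wt-m) , _) , (rep-m , _)) crit@((_ , least) , crit-S)
    z (w , (Cs , lcs , uniq , _ , w≡) , w-max) C lcC extC
  with u , v , u∈C , v∈C , zu , uv , ¬zv ← critical⇒escape G crit lcC extC
  = ∣pair∣≡2 u∈C v∈C u≢v C⊆uv
  where
  S : Subset n
  S = ∁ C ∪ (⁅ u ⁆ ∪ ⁅ v ⁆)

  u≢v : u ≢ v
  u≢v refl = contradiction (trans (sym zu) ¬zv) λ ()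

  ∉C⇒∈S : ∀ {x} → x ∉ C → x ∈ S
  ∉C⇒∈S x∉C = x∈p∪q⁺ (inj₁ (x∉p⇒x∈∁p x∉C))

  u∈S : u ∈ S
  u∈S = x∈p∪q⁺ (inj₂ (x∈p∪q⁺ (inj₁ (x∈⁅x⁆ u))))

  v∈S : v ∈ S
  v∈S = x∈p∪q⁺ (inj₂ (x∈p∪q⁺ (inj₂ (x∈⁅x⁆ v))))

  ≢C⇒⊆S : ∀ D → D ∈ˡ Cs → D ≢ C → D ⊆ S
  ≢C⇒⊆S D D∈ D≢C x∈D = ∉C⇒∈S λ x∈C → D≢C (localComponent-≡ G (All.lookup lcs D∈) lcC x∈D x∈C)

  escapes : ∀ D → D ∈ˡ Cs → Exterior G z D →
    ∃₂ λ u v → (u ∈ D × u ∈ S) × (v ∈ D × v ∈ S) ×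
               adj G z u ≡ true × adj G u v ≡ true × adj G z v ≡ false
  -- `C` keeps its chosen edge `uv`; any other component is disjoint from `C` and keeps every edge
  -- it had.
  escapes D D∈ ext with Vec.≡-dec Bool._≟_ D C
  ... | yes refl = u , v , (u∈C , u∈S) , (v∈C , v∈S) , zu , uv , ¬zv
  ... | no  D≢C
    with a , b , a∈ , b∈ , za , ab , ¬zb ← critical⇒escape G crit (All.lookup lcs D∈) ext =
    a , b , (a∈ , ≢C⇒⊆S D D∈ D≢C a∈) , (b∈ , ≢C⇒⊆S D D∈ D≢C b∈) , za , ab , ¬zb

  -- Balance enters here: `m` is attained as the impropriety of a representation, giving `p ≤ m`,
  -- and also as the weight of some vertex, giving `m ≤ w`.
  p≤w : p ≤ w
  p≤w = ℕ.≤-trans (least m rep-m) (w-max _ m wt-m)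

  all∈S : ∀ x → x ∈ S
  all∈S x with x ∈? S
  ... | yes x∈S = x∈S
  -- A vertex missing from `S` makes the subgraph proper, and the chain from `p` through `w` and the
  -- impropriety at `z` to `k` contradicts `k < p`.
  ... | no  x∉S with k , k<p , α , isRep , imp≤k ← crit-S S (x , x∉S) =
    contradiction (ℕ.≤-trans p≤w (ℕ.≤-trans w≤imp (imp≤k z z∈S))) (ℕ.<⇒≱ k<p)
    where
    z∈S : z ∈ S
    z∈S = ∉C⇒∈S (proj₁ lcC)
    w≤imp : w ≤ impAt G S α z
    w≤imp = subst (_≤ impAt G S α z) (sym w≡)
      (WeightBound.weight≤imp G z∈S isRep Cs lcs uniq escapes
        -- A non-exterior component differs from the exterior `C`, so no vertex of it was deleted.
        (λ D D∈ inner → ≢C⇒⊆S D D∈ λ { refl → inner extC }))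

  C⊆uv : C ⊆ ⁅ u ⁆ ∪ ⁅ v ⁆
  C⊆uv {x} x∈C = [ (λ x∈∁C → contradiction x∈C (x∈∁p⇒x∉p x∈∁C)) , id ]′
    (x∈p∪q⁻ (∁ C) (⁅ u ⁆ ∪ ⁅ v ⁆) (all∈S x))
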